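{- Let $N=\prod_{j=1}^r p_j^{k_j}\geq 2$, where $p_1,\dots,p_r$ are the pairwise distinct prime factors of $N$ (all $k_j\ge1$). Then for all $m\in\mathbb{N}$ we have $$\sum_{\substack{1\le i<N\\ \gcd(N,i)=1}}\sigma^i_1(m)-\varphi(N)\sigma^0_1(m)=\sum_{I\subseteq\{1,\dots,r\}}\left(\prod_{t\in I}\varphi(p_t^{k_t})\prod_{s\notin I}p_s^{k_s}\sum_{\substack{1\le i<N\\ p_t\mid i\ \forall t\in I,\ p_s\nmid i\ \forall s\notin I}}\kappa^i_1(m)\right).$$
   Context: $\varphi$ is Euler's totient function and $\eta=e^{2\pi i/N}$ (here $i=\sqrt{ -1}$). For $a\in\mathbb{Z}/N\mathbb{Z}$ and $m\in\mathbb{N}$, $$\sigma_1^a(m)=\sum_{nu=m}\eta^{au}u,\qquad \kappa_1^a(m)=\sum_{nu=m}\eta^{au}n,$$ the sums being over pairs of positive integers $(n,u)$ with $nu=m$. -}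

module Defs where

open import Algebra.Apartness.Bundles using (HeytingCommutativeRing; HeytingField)
open import Algebra.Bundles using (CommutativeRing)
import Algebra.Properties.Semiring.Exp as SemiringExp
import Algebra.Properties.Semiring.Mult as SemiringMult
open import Data.Bool.Base using (true; false)
open import Data.Fin.Base using (Fin)
open import Data.Fin.Properties using (all?)
open import Data.Fin.Subset using (Subset; _∈_; _∉_)
open import Data.Fin.Subset.Properties using (_∈?_)
open import Data.List.Base
  using (List; []; _∷_; _++_; map; filter; foldr; length; applyUpTo; cartesianProduct)
open import Data.Nat.Base using (ℕ; zero; suc; pred; _<_)
import Data.Nat.Base as ℕ
open import Data.Nat.Divisibility using (_∣_; _∤_; _∣?_)
open import Data.Nat.GCD using (gcd)
open import Data.Nat.ListAction using (product)
open import Data.Nat.Properties using (_≟_)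
open import Data.Product.Base using (_,_)
import Data.Product.Base as Prod
open import Data.Vec.Base using ([]; _∷_)
open import Level using (_⊔_)
open import Relation.Nullary.Decidable using (Dec; ¬?; _×-dec_; _→-dec_)

-- The integers i with 1 ≤ i < n.
positivesBelow : ℕ → List ℕ
positivesBelow n = applyUpTo suc (pred n)

totient : ℕ → ℕ
totient n = length (filter (λ k → gcd n k ≟ 1) (positivesBelow (suc n)))

coprimesBelow : ℕ → List ℕ
coprimesBelow n = filter (λ i → gcd n i ≟ 1) (positivesBelow n)

-- The pairs (n , u) of positive integers with n * u ≡ m (none if m is 0);
-- both entries of such a pair are at most m.
factorPairs : ℕ → List (ℕ Prod.× ℕ)
factorPairs m =
  filter (λ (n , u) → n ℕ.* u ≟ m)
    (cartesianProduct (positivesBelow (suc m)) (positivesBelow (suc m)))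

subsets : ∀ r → List (Subset r)
subsets zero    = [] ∷ []
subsets (suc r) = map (false ∷_) (subsets r) ++ map (true ∷_) (subsets r)

productOver : ∀ {a} {A : Set a} → List A → (A → ℕ) → ℕ
productOver xs f = product (map f xs)

infix 6 productOver
syntax productOver xs (λ x → e) = ∏[ x ∈ xs ] e

DivisiblePrecisely : ∀ {r} → (Fin r → ℕ) → Subset r → ℕ → Set
DivisiblePrecisely p I i =
  (∀ t → t ∈ I → p t ∣ i) Prod.× (∀ s → s ∉ I → p s ∤ i)

divisiblePrecisely? : ∀ {r} (p : Fin r → ℕ) (I : Subset r) (i : ℕ) →
                      Dec (DivisiblePrecisely p I i)
divisiblePrecisely? p I i =
  all? (λ t → (t ∈? I) →-dec (p t ∣? i)) ×-dec
  all? (λ s → ¬? (s ∈? I) →-dec ¬? (p s ∣? i))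

-- There are no complex numbers in the library. The field ℂ is replaced by an
-- arbitrary Heyting field (classically: a field, with _#_ being ≉), and
-- e^{2πi/N} by an arbitrary primitive N-th root of unity in it.
module Sums {c ℓ₁ ℓ₂} (K : HeytingField c ℓ₁ ℓ₂) where

  open HeytingField K public
    using (Carrier; _≈_; _#_; _+_; _*_; -_; _-_; 0#; 1#)

  private
    semiring =
      CommutativeRing.semiring
        (HeytingCommutativeRing.commutativeRing
          (HeytingField.heytingCommutativeRing K))

  -- n × x is the natural multiple x + ⋯ + x, and x ^ n the natural power.
  open SemiringMult semiring public using (_×_)
  open SemiringExp semiring public using (_^_)

  sumOver : ∀ {a} {A : Set a} → List A → (A → Carrier) → Carrier
  sumOver xs f = foldr _+_ 0# (map f xs)

  infix 7 sumOver
  syntax sumOver xs (λ x → e) = ∑[ x ∈ xs ] e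

  IsPrimitiveRoot : ℕ → Carrier → Set (ℓ₁ ⊔ ℓ₂)
  IsPrimitiveRoot N η =
    (η ^ N ≈ 1#) Prod.× (∀ k → 0 < k → k < N → (η ^ k) # 1#)

  -- The superscript a is a residue class modulo the order of η, given by a
  -- natural number representing it.
  σ₁ : Carrier → ℕ → ℕ → Carrier
  σ₁ η a m = ∑[ (n , u) ∈ factorPairs m ] (u × (η ^ (a ℕ.* u)))

  κ₁ : Carrier → ℕ → ℕ → Carrier
  κ₁ η a m = ∑[ (n , u) ∈ factorPairs m ] (n × (η ^ (a ℕ.* u)))

{-# OPTIONS --safe #-}

-- Extend the sums over i to 0 ≤ i < N; the term i = 0 of the right-hand side is
-- φ(N) σ₁⁰(m). With weights w on the residues, put σ(w) = Σᵢ w(i) σ₁ⁱ(m) and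
-- κ(w) = Σᵢ w(i) κ₁ⁱ(m). For fixed i exactly one I contributes on the right, so
-- the claim is
--   σ (∏ⱼ (1 - [pⱼ ∣ i])) = κ (N ∏ⱼ (1 - [pⱼ ∣ i] / pⱼ)).
-- Expanding both products into indicators [d ∣ i], d ∣ N, reduces this to
--   σ [d ∣ i] = e κ [d ∣ i],   d e = N.
-- By orthogonality of characters both sides are sums over n u = m with e ∣ u, of
-- e u and of e² n respectively; they agree because, with u = e v, the condition
-- n e v = m is symmetric in n and v. The same expansion, applied to the
-- functionals Σᵢ w(i) and w(0), gives φ(N) = N ∏ⱼ (1 - 1 / pⱼ).
module Submission where

open import Defs
open import Algebra.Apartness.Bundles using (HeytingCommutativeRing; HeytingField)
open import Algebra.Bundles using (CommutativeMonoid; CommutativeRing)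
open import Algebra.Definitions using (LeftCancellative)
import Algebra.Properties.AbelianGroup as AbelianGroupProperties
import Algebra.Properties.CommutativeMonoid.Mult as MonoidMult
import Algebra.Properties.CommutativeSemigroup as CommSemigroup
import Algebra.Properties.Group as GroupProperties
import Algebra.Properties.Ring as RingProperties
import Algebra.Properties.Semiring.Exp as SemiringExp
open import Data.Bool.Base using (Bool; true; false; if_then_else_; not)
open import Data.Fin.Base using (Fin; zero; suc)
open import Data.Fin.Subset using (Subset)
open import Data.Fin.Subset.Properties using (_∈?_; drop-there)
open import Data.List.Base
  using (List; []; _∷_; _++_; map; filter; foldr; length; applyUpTo; upTo; cartesianProduct; allFin)
open import Data.List.Membership.Propositional using (_∈_)
open import Data.List.Membership.Propositional.Properties using (∈-map⁺; ∈-allFin)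
open import Data.List.Properties using (map-∘; map-applyUpTo; map-tabulate; upTo-∷ʳ)
open import Data.List.Relation.Unary.All as All using (All; []; _∷_)
import Data.List.Relation.Unary.All.Properties as Allₚ
open import Data.List.Relation.Unary.AllPairs as AllPairs using (AllPairs; []; _∷_)
import Data.List.Relation.Unary.AllPairs.Properties as AllPairsₚ
open import Data.List.Relation.Unary.Any using (here; there)
open import Data.List.Relation.Unary.Unique.Propositional.Properties using (allFin⁺)
open import Data.Nat.Base as ℕ
  using (ℕ; zero; suc; pred; _<_; _≤_; _∸_; NonZero; NonTrivial; z≤n; s≤s)
open import Data.Nat.Coprimality as Coprimality using (Coprime)
open import Data.Nat.Divisibility
open import Data.Nat.DivMod using (_/_; _%_; m≡m%n+[m/n]*n; m%n<n)
open import Data.Nat.GCD using (gcd; gcd[m,n]∣m; gcd[m,n]∣n; gcd[m,n]≢0; gcd-greatest)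
open import Data.Nat.ListAction using (sum; product)
open import Data.Nat.Primality
  using (Prime; prime⇒nonZero; prime⇒nonTrivial; prime⇒irreducible; euclidsLemma)
open import Data.Nat.Primality.Factorisation using (factorise)
import Data.Nat.Properties as ℕₚ
open import Data.Nat.Solver using (module +-*-Solver)
open import Data.Product.Base as Prod using (_,_; proj₁; proj₂; ∃)
open import Data.Sum.Base using (inj₁; inj₂)
open import Data.Vec.Base as Vec using (here; there)
open import Function.Base using (_∘_; _on_; id; const; it)
open import Function.Bundles using (_⇔_; mk⇔)
open import Function.Definitions using (Injective)
open import Relation.Binary.PropositionalEquality as ≡
  using (_≡_; _≢_; refl; cong; cong₂; module ≡-Reasoning)
import Relation.Binary.Reasoning.Setoid as SetoidReasoning
open import Relation.Nullary.Decidable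
  using (Dec; yes; no; does; ¬?; _×-dec_; dec-true; dec-false; does-⇔)
open import Relation.Nullary.Negation using (¬_; contradiction)
open import Relation.Unary using (Pred; Decidable)

-- Indicators of decidable propositions.

𝟙 : ∀ {a} {A : Set a} → Dec A → ℕ
𝟙 A? = if does A? then 1 else 0

𝟙-true : ∀ {a} {A : Set a} (A? : Dec A) → A → 𝟙 A? ≡ 1
𝟙-true A? a = cong (if_then 1 else 0) (dec-true A? a)

𝟙-false : ∀ {a} {A : Set a} (A? : Dec A) → ¬ A → 𝟙 A? ≡ 0
𝟙-false A? ¬a = cong (if_then 1 else 0) (dec-false A? ¬a)

𝟙-⇔ : ∀ {a b} {A : Set a} {B : Set b} → A ⇔ B →
      (A? : Dec A) (B? : Dec B) → 𝟙 A? ≡ 𝟙 B?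
𝟙-⇔ A⇔B A? B? = cong (if_then 1 else 0) (does-⇔ A⇔B A? B?)

-- Finite sums in a commutative monoid.

module FiniteSum {c ℓ} (M : CommutativeMonoid c ℓ) where

  open CommutativeMonoid M
    renaming (_∙_ to _+_; ε to 0#; ∙-cong to +-cong; ∙-congˡ to +-congˡ;
              ∙-congʳ to +-congʳ; identityˡ to +-identityˡ;
              identityʳ to +-identityʳ; assoc to +-assoc)
    renaming (refl to ≈-refl)
  open MonoidMult M
  open CommSemigroup commutativeSemigroup using (interchange)
  open SetoidReasoning setoid

  -- The monoid is left abstract because three instances occur: `ℕ` under addition, `ℕ` under
  -- multiplication, where this unfolds to `productOver`, and the additive monoid of `K`, where it
  -- unfolds to `sumOver`.
  sumOf : ∀ {a} {A : Set a} → List A → (A → Carrier) → Carrier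
  sumOf xs f = foldr _+_ 0# (map f xs)

  ×-zeroʳ : ∀ n → n × 0# ≈ 0#
  ×-zeroʳ zero    = ≈-refl
  ×-zeroʳ (suc n) = trans (+-identityˡ _) (×-zeroʳ n)

  module _ {a} {A : Set a} where

    sum-cong : ∀ (xs : List A) {f g} → (∀ x → f x ≈ g x) → sumOf xs f ≈ sumOf xs g
    sum-cong []       f≈g = ≈-refl
    sum-cong (x ∷ xs) f≈g = +-cong (f≈g x) (sum-cong xs f≈g)

    sum-zero : ∀ (xs : List A) → sumOf xs (λ _ → 0#) ≈ 0#
    sum-zero []       = ≈-refl
    sum-zero (x ∷ xs) = trans (+-identityˡ _) (sum-zero xs)

    sum-+ : ∀ (xs : List A) f g → sumOf xs (λ x → f x + g x) ≈ sumOf xs f + sumOf xs g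
    sum-+ []       f g = sym (+-identityˡ 0#)
    sum-+ (x ∷ xs) f g = trans (+-congˡ (sum-+ xs f g)) (interchange _ _ _ _)

    sum-× : ∀ (xs : List A) n f → sumOf xs (λ x → n × f x) ≈ n × sumOf xs f
    sum-× []       n f = sym (×-zeroʳ n)
    sum-× (x ∷ xs) n f = trans (+-congˡ (sum-× xs n f)) (sym (×-distrib-+ _ _ n))

    sum-++ : ∀ (xs ys : List A) f → sumOf (xs ++ ys) f ≈ sumOf xs f + sumOf ys f
    sum-++ []       ys f = sym (+-identityˡ _)
    sum-++ (x ∷ xs) ys f = trans (+-congˡ (sum-++ xs ys f)) (sym (+-assoc _ _ _))

    sum-filter : ∀ {p} {P : Pred A p} (P? : Decidable P) (xs : List A) f →
                 sumOf (filter P? xs) f ≈ sumOf xs (λ x → if does (P? x) then f x else 0#)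
    sum-filter P? []       f = ≈-refl
    sum-filter P? (x ∷ xs) f with does (P? x)
    ... | true  = +-congˡ (sum-filter P? xs f)
    ... | false = trans (sum-filter P? xs f) (sym (+-identityˡ _))

    -- Moves the condition of the filter into a natural-number weight, the form in which the sieve
    -- treats conditions on the index.
    sum-filter-𝟙 : ∀ {p} {P : Pred A p} (P? : Decidable P) (xs : List A) f →
                   sumOf (filter P? xs) f ≈ sumOf xs (λ x → 𝟙 (P? x) × f x)
    sum-filter-𝟙 P? xs f = trans (sum-filter P? xs f) (sum-cong xs λ x → if≈× (does (P? x)) (f x))
      where
      if≈× : ∀ b y → (if b then y else 0#) ≈ (if b then 1 else 0) × y
      if≈× true  y = sym (+-identityʳ y)
      if≈× false y = ≈-refl

    sum-map : ∀ {b} {B : Set b} (g : B → A) xs f → sumOf (map g xs) f ≡ sumOf xs (f ∘ g)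
    sum-map g xs f = cong (foldr _+_ 0#) (≡.sym (map-∘ xs))

  sum-swap : ∀ {a b} {A : Set a} {B : Set b} (xs : List A) (ys : List B) (f : A → B → Carrier) →
             sumOf xs (λ x → sumOf ys (f x)) ≈ sumOf ys (λ y → sumOf xs (λ x → f x y))
  sum-swap []       ys f = sym (sum-zero ys)
  sum-swap (x ∷ xs) ys f = trans (+-congˡ (sum-swap xs ys f)) (sym (sum-+ ys _ _))

  sum-cartesianProduct : ∀ {a b} {A : Set a} {B : Set b} (xs : List A) (ys : List B) f →
    sumOf (cartesianProduct xs ys) f ≈ sumOf xs (λ x → sumOf ys (λ y → f (x , y)))
  sum-cartesianProduct []       ys f = ≈-refl
  sum-cartesianProduct (x ∷ xs) ys f = begin
    sumOf (map (x ,_) ys ++ cartesianProduct xs ys) f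
      ≈⟨ sum-++ (map (x ,_) ys) _ f ⟩
    sumOf (map (x ,_) ys) f + sumOf (cartesianProduct xs ys) f
      ≈⟨ +-cong (reflexive (sum-map (x ,_) ys f)) (sum-cartesianProduct xs ys f) ⟩
    sumOf ys (λ y → f (x , y)) + sumOf xs (λ x → sumOf ys (λ y → f (x , y))) ∎

  sum-×ˡ : ∀ {a} {A : Set a} (xs : List A) (w : A → ℕ) y →
           sumOf xs (λ x → w x × y) ≈ sum (map w xs) × y
  sum-×ˡ []       w y = ≈-refl
  sum-×ˡ (x ∷ xs) w y = trans (+-congˡ (sum-×ˡ xs w y)) (sym (×-homo-+ y (w x) _))

  sum-applyUpTo : ∀ (g : ℕ → ℕ) n f → sumOf (applyUpTo g n) f ≡ sumOf (upTo n) (f ∘ g)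
  sum-applyUpTo g n f = cong (foldr _+_ 0#)
    (≡.trans (map-applyUpTo g f n) (≡.sym (map-applyUpTo id (f ∘ g) n)))

  sum-upTo-suc : ∀ n f → sumOf (upTo (suc n)) f ≈ f 0 + sumOf (upTo n) (f ∘ suc)
  sum-upTo-suc n f = +-congˡ (reflexive (sum-applyUpTo suc n f))

  sum-upTo-const : ∀ n x → sumOf (upTo n) (const x) ≈ n × x
  sum-upTo-const zero    x = ≈-refl
  sum-upTo-const (suc n) x = trans (sum-upTo-suc n (const x)) (+-congˡ (sum-upTo-const n x))

  sum-upTo-∷ʳ : ∀ n f → sumOf (upTo (suc n)) f ≈ sumOf (upTo n) f + f n
  sum-upTo-∷ʳ n f = begin
    sumOf (upTo (suc n)) f          ≡⟨ cong (λ xs → sumOf xs f) (upTo-∷ʳ n) ⟨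
    sumOf (upTo n ++ n ∷ []) f      ≈⟨ sum-++ (upTo n) (n ∷ []) f ⟩
    sumOf (upTo n) f + (f n + 0#)   ≈⟨ +-congˡ (+-identityʳ (f n)) ⟩
    sumOf (upTo n) f + f n          ∎

  sum-upTo-zero : ∀ n {f} → (∀ i → i < n → f i ≈ 0#) → sumOf (upTo n) f ≈ 0#
  sum-upTo-zero zero    f≈0 = ≈-refl
  sum-upTo-zero (suc n) {f} f≈0 = begin
    sumOf (upTo (suc n)) f          ≈⟨ sum-upTo-suc n f ⟩
    f 0 + sumOf (upTo n) (f ∘ suc)  ≈⟨ +-cong (f≈0 0 (s≤s z≤n)) (sum-upTo-zero n (λ i → f≈0 (suc i) ∘ s≤s)) ⟩
    0# + 0#                         ≈⟨ +-identityˡ 0# ⟩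
    0#                              ∎

  sum-upTo-+ : ∀ m n f → sumOf (upTo (m ℕ.+ n)) f ≈ sumOf (upTo m) f + sumOf (upTo n) (f ∘ (m ℕ.+_))
  sum-upTo-+ zero    n f = sym (+-identityˡ _)
  sum-upTo-+ (suc m) n f = begin
    sumOf (upTo (suc m ℕ.+ n)) f
      ≈⟨ sum-upTo-suc (m ℕ.+ n) f ⟩
    f 0 + sumOf (upTo (m ℕ.+ n)) (f ∘ suc)
      ≈⟨ +-congˡ (sum-upTo-+ m n (f ∘ suc)) ⟩
    f 0 + (sumOf (upTo m) (f ∘ suc) + sumOf (upTo n) (f ∘ (suc m ℕ.+_)))
      ≈⟨ +-assoc _ _ _ ⟨
    f 0 + sumOf (upTo m) (f ∘ suc) + sumOf (upTo n) (f ∘ (suc m ℕ.+_))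
      ≈⟨ +-congʳ (sum-upTo-suc m f) ⟨
    sumOf (upTo (suc m)) f + sumOf (upTo n) (f ∘ (suc m ℕ.+_)) ∎

  -- The range is cut into `n` blocks of length `d`. In each block only the first index is a
  -- multiple of `d`, and shifting `f` by `d` preserves the hypothesis, which drives the induction.
  sum-multiples : ∀ n d .{{_ : NonZero d}} f → (∀ i → d ∤ i → f i ≈ 0#) →
                  sumOf (upTo (n ℕ.* d)) f ≈ sumOf (upTo n) (λ j → f (j ℕ.* d))
  sum-multiples zero    d f f≈0 = ≈-refl
  sum-multiples (suc n) d@(suc d-1) f f≈0 = begin
    sumOf (upTo (d ℕ.+ n ℕ.* d)) f
      ≈⟨ sum-upTo-+ d (n ℕ.* d) f ⟩
    sumOf (upTo d) f + sumOf (upTo (n ℕ.* d)) (f ∘ (d ℕ.+_))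
      ≈⟨ +-cong
           (trans (sum-upTo-suc d-1 f) (trans
             (+-congˡ (sum-upTo-zero d-1 λ i i<d-1 → f≈0 (suc i) (>⇒∤ (s≤s i<d-1))))
             (+-identityʳ (f 0))))
           (sum-multiples n d (f ∘ (d ℕ.+_)) λ i d∤i → f≈0 (d ℕ.+ i) (d∤i ∘ λ d∣d+i → ∣m+n∣m⇒∣n d∣d+i ∣-refl)) ⟩
    f 0 + sumOf (upTo n) (λ j → f (d ℕ.+ j ℕ.* d))
      ≈⟨ sum-upTo-suc n (λ j → f (j ℕ.* d)) ⟨
    sumOf (upTo (suc n)) (λ j → f (j ℕ.* d)) ∎

module ℕ-Sum where
  open FiniteSum ℕₚ.+-0-commutativeMonoid public
  open MonoidMult ℕₚ.+-0-commutativeMonoid public using (_×_)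

  ×≡* : ∀ m n → m × n ≡ m ℕ.* n
  ×≡* zero    n = refl
  ×≡* (suc m) n = cong (n ℕ.+_) (×≡* m n)

  sum-*ˡ : ∀ {a} {A : Set a} (xs : List A) n f → sumOf xs (λ x → n ℕ.* f x) ≡ n ℕ.* sumOf xs f
  sum-*ˡ xs n f = begin
    sumOf xs (λ x → n ℕ.* f x)  ≡⟨ sum-cong xs (λ x → ×≡* n (f x)) ⟨
    sumOf xs (λ x → n × f x)    ≡⟨ sum-× xs n f ⟩
    n × sumOf xs f              ≡⟨ ×≡* n _ ⟩
    n ℕ.* sumOf xs f            ∎
    where open ≡-Reasoning

-- A sieve for additive functionals on weights.

coprime-*-∣ : ∀ {d p i} → Coprime d p → d ∣ i → p ∣ i → d ℕ.* p ∣ i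
coprime-*-∣ {d} {p} c (divides q refl) p∣i =
  ≡.subst (_∣ q ℕ.* d) (ℕₚ.*-comm p d)
    (*-monoˡ-∣ d (Coprimality.coprime-divisor (Coprimality.sym c) (≡.subst (p ∣_) (ℕₚ.*-comm q d) p∣i)))

𝟙-∣-* : ∀ {d p} → Coprime d p → ∀ i → 𝟙 (d ℕ.* p ∣? i) ≡ 𝟙 (d ∣? i) ℕ.* 𝟙 (p ∣? i)
𝟙-∣-* {d} {p} c i with d ∣? i | p ∣? i
... | no d∤i  | _       = 𝟙-false (d ℕ.* p ∣? i) (d∤i ∘ m*n∣⇒m∣ d p)
... | yes d∣i | no p∤i  = 𝟙-false (d ℕ.* p ∣? i) (p∤i ∘ m*n∣⇒n∣ d p)
... | yes d∣i | yes p∣i = 𝟙-true (d ℕ.* p ∣? i) (coprime-*-∣ c d∣i p∣i)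

avoiding : List ℕ → ℕ → ℕ
avoiding L i = ∏[ p ∈ L ] 𝟙 (¬? (p ∣? i))

-- If N = e * product L then e * deficient L i is N ∏ (1 - [p ∣ i] / p), the product over p ∈ L.
deficient : List ℕ → ℕ → ℕ
deficient L i = ∏[ p ∈ L ] (p ∸ 𝟙 (p ∣? i))

coprime-* : ∀ {d p q} → Coprime d q → Coprime p q → Coprime (d ℕ.* p) q
coprime-* {d} {p} {q} dq pq {c} (c∣dp , c∣q) =
  pq (Coprimality.coprime-divisor (λ (x , y) → dq (y , ∣-trans x c∣q)) c∣dp , c∣q)

module _ {c ℓ} (M : CommutativeMonoid c ℓ) where

  open CommutativeMonoid M using (Carrier; _≈_; setoid; trans; ∙-congʳ) renaming (_∙_ to _+_)

  -- `A` and `B` stay abstract so that one sieve serves both the totient (sum over residues against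
  -- the value at 0) and the comparison of `σ₁` with `κ₁`. Weights take values in `ℕ`, so additivity
  -- together with cancellation in `M` replaces the signs of inclusion-exclusion. `base` is the
  -- comparison on indicators of multiples.
  module _
    (cancelˡ : LeftCancellative _≈_ _+_)
    (A B : (ℕ → ℕ) → Carrier)
    (A-cong : ∀ {f g} → (∀ i → f i ≡ g i) → A f ≈ A g)
    (B-cong : ∀ {f g} → (∀ i → f i ≡ g i) → B f ≈ B g)
    (A-+ : ∀ f g → A (λ i → f i ℕ.+ g i) ≈ A f + A g)
    (B-+ : ∀ f g → B (λ i → f i ℕ.+ g i) ≈ B f + B g)
    (N : ℕ)
    (base : ∀ d e → e ℕ.* d ≡ N → A (λ i → 𝟙 (d ∣? i)) ≈ B (λ i → e ℕ.* 𝟙 (d ∣? i)))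
    where

    -- Induction on `L`; `d` collects the primes whose divisibility is already imposed, and `e` is
    -- the remaining cofactor. The weight for `L` splits into the weight for `p ∷ L` and the weight
    -- for `L` with `d * p` in place of `d`: for `A` because 1 = [p ∣ i] + [p ∤ i], for `B` because
    -- p = [p ∣ i] + (p - [p ∣ i]). Two of the three terms agree by induction, hence so does the
    -- third. Coprimality gives [d p ∣ i] = [d ∣ i] [p ∣ i].
    sieve-from : ∀ {L} → AllPairs Coprime L → All Prime L → ∀ {d} → All (Coprime d) L →
                 ∀ e → e ℕ.* product L ℕ.* d ≡ N →
                 A (λ i → 𝟙 (d ∣? i) ℕ.* avoiding L i) ≈
                 B (λ i → e ℕ.* (𝟙 (d ∣? i) ℕ.* deficient L i))
    sieve-from {[]} _ _ {d} _ e eq =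
      trans (A-cong (λ i → ℕₚ.*-identityʳ _))
      (trans (base d e (≡.trans (cong (ℕ._* d) (≡.sym (ℕₚ.*-identityʳ e))) eq))
             (B-cong (λ i → cong (e ℕ.*_) (≡.sym (ℕₚ.*-identityʳ _)))))
    sieve-from {p ∷ L} (c ∷ cs) (pr ∷ prs) {d} (cd ∷ cds) e eq =
      cancelˡ _ _ _ (begin
        A (λ i → 𝟙 (d ℕ.* p ∣? i) ℕ.* avoiding L i) +
        A (λ i → 𝟙 (d ∣? i) ℕ.* avoiding (p ∷ L) i)
          ≈⟨ A-+ _ _ ⟨
        A (λ i → 𝟙 (d ℕ.* p ∣? i) ℕ.* avoiding L i ℕ.+ 𝟙 (d ∣? i) ℕ.* avoiding (p ∷ L) i)
          ≈⟨ A-cong split-avoiding ⟩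
        A (λ i → 𝟙 (d ∣? i) ℕ.* avoiding L i)
          -- `p` has left the list: here the cofactor absorbs it, in the second use of the induction
          -- hypothesis below `d` does.
          ≈⟨ sieve-from cs prs cds (e ℕ.* p) eq₁ ⟩
        B (λ i → e ℕ.* p ℕ.* (𝟙 (d ∣? i) ℕ.* deficient L i))
          ≈⟨ B-cong split-deficient ⟨
        B (λ i → e ℕ.* (𝟙 (d ℕ.* p ∣? i) ℕ.* deficient L i) ℕ.+
                 e ℕ.* (𝟙 (d ∣? i) ℕ.* deficient (p ∷ L) i))
          ≈⟨ B-+ _ _ ⟩
        B (λ i → e ℕ.* (𝟙 (d ℕ.* p ∣? i) ℕ.* deficient L i)) +
        B (λ i → e ℕ.* (𝟙 (d ∣? i) ℕ.* deficient (p ∷ L) i))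
          ≈⟨ ∙-congʳ (sieve-from cs prs (All.map coprime-*-proj (All.zip (cds , c))) e eq₂) ⟨
        A (λ i → 𝟙 (d ℕ.* p ∣? i) ℕ.* avoiding L i) +
        B (λ i → e ℕ.* (𝟙 (d ∣? i) ℕ.* deficient (p ∷ L) i)) ∎)
      where
      open SetoidReasoning setoid
      open +-*-Solver

      coprime-*-proj : ∀ {q} → Coprime d q Prod.× Coprime p q → Coprime (d ℕ.* p) q
      coprime-*-proj (dq , pq) = coprime-* dq pq

      eq₁ : e ℕ.* p ℕ.* product L ℕ.* d ≡ N
      eq₁ = ≡.trans (cong (ℕ._* d) (ℕₚ.*-assoc e p (product L))) eq

      eq₂ : e ℕ.* product L ℕ.* (d ℕ.* p) ≡ N
      eq₂ = ≡.trans
        (solve 4 (λ e P d p → e :* P :* (d :* p) := e :* (p :* P) :* d) refl e (product L) d p) eq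

      split-avoiding : ∀ i → 𝟙 (d ℕ.* p ∣? i) ℕ.* avoiding L i ℕ.+ 𝟙 (d ∣? i) ℕ.* avoiding (p ∷ L) i
                             ≡ 𝟙 (d ∣? i) ℕ.* avoiding L i
      split-avoiding i rewrite 𝟙-∣-* cd i with p ∣? i
      ... | yes _ = solve 2 (λ δ X → δ :* con 1 :* X :+ δ :* con 0 := δ :* X) refl (𝟙 (d ∣? i)) (avoiding L i)
      ... | no  _ = solve 2 (λ δ X → δ :* con 0 :* X :+ δ :* (con 1 :* X) := δ :* X) refl (𝟙 (d ∣? i)) (avoiding L i)

      split-deficient : ∀ i → e ℕ.* (𝟙 (d ℕ.* p ∣? i) ℕ.* deficient L i) ℕ.+
                              e ℕ.* (𝟙 (d ∣? i) ℕ.* deficient (p ∷ L) i)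
                              ≡ e ℕ.* p ℕ.* (𝟙 (d ∣? i) ℕ.* deficient L i)
      split-deficient i rewrite 𝟙-∣-* cd i with p ∣? i
      ... | no _  = solve 4 (λ e p δ Y → e :* (δ :* con 0 :* Y) :+ e :* (δ :* (p :* Y)) := e :* p :* (δ :* Y))
                      refl e p (𝟙 (d ∣? i)) (deficient L i)
      -- The truncated difference `p ∸ 1` is an atom `q` for the solver; `p = 1 + q` is supplied
      -- afterwards, a prime being positive.
      ... | yes _ = ≡.trans
        (solve 4 (λ e q δ Y → e :* (δ :* con 1 :* Y) :+ e :* (δ :* (q :* Y)) := e :* (con 1 :+ q) :* (δ :* Y))
          refl e (p ∸ 1) (𝟙 (d ∣? i)) (deficient L i))
        (cong (λ q → e ℕ.* q ℕ.* (𝟙 (d ∣? i) ℕ.* deficient L i))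
          (ℕₚ.m+[n∸m]≡n (ℕ.>-nonZero⁻¹ p {{prime⇒nonZero pr}})))

    sieve : ∀ {L} → AllPairs Coprime L → All Prime L → ∀ e → e ℕ.* product L ≡ N →
            A (avoiding L) ≈ B (λ i → e ℕ.* deficient L i)
    sieve {L} cs prs e eq =
      trans (A-cong (λ i → ≡.sym (drop-1 i _)))
      (trans (sieve-from cs prs {1}
               (All.universal {P = Coprime 1} (λ q → Coprimality.1-coprimeTo q) L) e (≡.trans (ℕₚ.*-identityʳ _) eq))
             (B-cong (λ i → cong (e ℕ.*_) (drop-1 i _))))
      where
      drop-1 : ∀ i x → 𝟙 (1 ∣? i) ℕ.* x ≡ x
      drop-1 i x = ≡.trans (cong (ℕ._* x) (𝟙-true (1 ∣? i) (1∣ i))) (ℕₚ.*-identityˡ x)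

-- Prime divisors and the radical of an integer.

module ℕ-Product = FiniteSum ℕₚ.*-1-commutativeMonoid
open ℕ-Sum using (sumOf)

𝟙-×-dec : ∀ {a b} {A : Set a} {B : Set b} (A? : Dec A) (B? : Dec B) →
          𝟙 (A? ×-dec B?) ≡ 𝟙 A? ℕ.* 𝟙 B?
𝟙-×-dec A? B? with does A?
... | true  = ≡.sym (ℕₚ.*-identityˡ _)
... | false = refl

prime-divisor : ∀ n .{{_ : NonZero n}} → n ≢ 1 → ∃ λ q → Prime q Prod.× q ∣ n
prime-divisor n n≢1 with factorise n
... | record { factors = [] ; isFactorisation = n≡1 } = contradiction n≡1 n≢1
... | record { factors = q ∷ qs ; isFactorisation = refl ; factorsPrime = pr ∷ _ } =
  q , pr , ∣m⇒∣m*n (product qs) ∣-refl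

prime-∣⇒≡ : ∀ {q p} → Prime q → Prime p → q ∣ p → q ≡ p
prime-∣⇒≡ pq pp q∣p with prime⇒irreducible pp q∣p
... | inj₁ refl = contradiction (prime⇒nonTrivial pq) λ ()
... | inj₂ q≡p  = q≡p

distinct-primes-coprime : ∀ {p q} → Prime p → Prime q → p ≢ q → Coprime p q
distinct-primes-coprime pp pq p≢q (c∣p , c∣q) with prime⇒irreducible pp c∣p
... | inj₁ c≡1  = c≡1
... | inj₂ refl = contradiction (prime-∣⇒≡ pp pq c∣q) p≢q

prime-∣-^ : ∀ {q} → Prime q → ∀ a k → q ∣ a ℕ.^ k → q ∣ a
prime-∣-^ pq a zero    q∣1 = contradiction (≡.subst NonTrivial (∣1⇒≡1 q∣1) (prime⇒nonTrivial pq)) λ ()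
prime-∣-^ pq a (suc k) q∣aᵏ⁺¹ with euclidsLemma a (a ℕ.^ k) pq q∣aᵏ⁺¹
... | inj₁ q∣a  = q∣a
... | inj₂ q∣aᵏ = prime-∣-^ pq a k q∣aᵏ

prime-∣-product : ∀ {q} → Prime q → ∀ {a} {A : Set a} (xs : List A) (f : A → ℕ) →
                  q ∣ productOver xs f → ∃ λ x → q ∣ f x
prime-∣-product pq []       f q∣1 = contradiction (≡.subst NonTrivial (∣1⇒≡1 q∣1) (prime⇒nonTrivial pq)) λ ()
prime-∣-product pq (x ∷ xs) f q∣ with euclidsLemma (f x) _ pq q∣
... | inj₁ q∣fx = x , q∣fx
... | inj₂ q∣xs = prime-∣-product pq xs f q∣xs

∏-𝟙 : ∀ {a p} {A : Set a} {P : Pred A p} (P? : Decidable P) xs →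
      ∏[ x ∈ xs ] 𝟙 (P? x) ≡ 𝟙 (All.all? P? xs)
∏-𝟙 P? []       = refl
∏-𝟙 P? (x ∷ xs) with does (P? x)
... | true  = ≡.trans (ℕₚ.*-identityˡ _) (∏-𝟙 P? xs)
... | false = refl

-- rad n = ∏ L and n = e · rad n
record RadicalFactorisation (n e : ℕ) (L : List ℕ) : Set where
  field
    coprime  : AllPairs Coprime L
    prime    : All Prime L
    factor   : e ℕ.* product L ≡ n
    complete : ∀ {q} → Prime q → q ∣ n → q ∈ L

  -- A gcd other than 1 has a prime divisor, which divides `n` and so lies in `L` by `complete`.
  -- Conversely every member of `L` divides `n` by `factor`, so it cannot divide an `i` coprime to
  -- `n`.
  avoiding≡𝟙-coprime : .{{_ : NonZero n}} → ∀ i → avoiding L i ≡ 𝟙 (gcd n i ℕₚ.≟ 1)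
  avoiding≡𝟙-coprime i = ≡.trans (∏-𝟙 (λ p → ¬? (p ∣? i)) L)
    (𝟙-⇔ (mk⇔ to from) (All.all? (λ p → ¬? (p ∣? i)) L) (gcd n i ℕₚ.≟ 1))
    where
    p∈L⇒p∣product : ∀ {p L} → p ∈ L → p ∣ product L
    p∈L⇒p∣product {L = x ∷ xs} (here refl) = ∣m⇒∣m*n (product xs) ∣-refl
    p∈L⇒p∣product {L = x ∷ xs} (there p∈)  = ∣n⇒∣m*n x (p∈L⇒p∣product p∈)

    to : All (_∤ i) L → gcd n i ≡ 1
    to avoid with gcd n i ℕₚ.≟ 1
    ... | yes g≡1 = g≡1
    ... | no  g≢1 with prime-divisor (gcd n i) {{ℕ.≢-nonZero (gcd[m,n]≢0 n i (inj₁ (ℕ.≢-nonZero⁻¹ n)))}} g≢1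
    ...   | q , pq , q∣g = contradiction (∣-trans q∣g (gcd[m,n]∣n n i))
                             (All.lookup avoid (complete pq (∣-trans q∣g (gcd[m,n]∣m n i))))

    from : gcd n i ≡ 1 → All (_∤ i) L
    from g≡1 = All.tabulate λ {p} p∈L p∣i →
      contradiction
        (≡.subst NonTrivial
          (∣1⇒≡1 (≡.subst (p ∣_) g≡1
            (gcd-greatest (≡.subst (p ∣_) factor (∣n⇒∣m*n e (p∈L⇒p∣product p∈L))) p∣i)))
          (prime⇒nonTrivial (All.lookup prime p∈L)))
        λ ()

-- The product formula for Euler's totient.

length-filter : ∀ {a p} {A : Set a} {P : Pred A p} (P? : Decidable P) xs →
                length (filter P? xs) ≡ sumOf xs (λ x → 𝟙 (P? x))
length-filter P? []       = refl
length-filter P? (x ∷ xs) with does (P? x)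
... | true  = cong suc (length-filter P? xs)
... | false = length-filter P? xs

-- The sieve is applied to the sum over residues and to evaluation at 0. Every prime divides 0, so
-- `deficient L 0` is the product of the p - 1, and the formula is φ(n) = n ∏ (1 - 1/p).
totient-formula : ∀ {n e L} .{{_ : NonZero n}} → RadicalFactorisation n e L →
                  totient n ≡ e ℕ.* deficient L 0
totient-formula {n} {e} {L} rad = begin
  totient n
    ≡⟨ length-filter (λ k → gcd n k ℕₚ.≟ 1) (positivesBelow (suc n)) ⟩
  sumOf (applyUpTo suc n) coprime?
    ≡⟨ ℕ-Sum.sum-applyUpTo suc n coprime? ⟩
  sumOf (upTo n) (coprime? ∘ suc)
    ≡⟨ ℕₚ.+-cancelˡ-≡ (coprime? 0) _ _ shift ⟩
  sumOf (upTo n) coprime?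
    ≡⟨ ℕ-Sum.sum-cong (upTo n) avoiding≡𝟙-coprime ⟨
  sumOf (upTo n) (avoiding L)
    ≡⟨ sieve ℕₚ.+-0-commutativeMonoid ℕₚ.+-cancelˡ-≡
         (sumOf (upTo n)) (λ f → f 0)
         (ℕ-Sum.sum-cong (upTo n)) (λ f≡g → f≡g 0)
         (ℕ-Sum.sum-+ (upTo n)) (λ _ _ → refl) n count-multiples
         coprime prime e factor ⟩
  e ℕ.* deficient L 0 ∎
  where
  open ≡-Reasoning
  open RadicalFactorisation rad

  coprime? : ℕ → ℕ
  coprime? i = 𝟙 (gcd n i ℕₚ.≟ 1)

  -- `totient` counts over 1, ..., n while the sieve runs over 0, ..., n - 1. The two end terms
  -- agree because gcd(n, n) = gcd(n, 0); the term at 0 is added on both sides in order to be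
  -- cancelled.
  shift : coprime? 0 ℕ.+ sumOf (upTo n) (coprime? ∘ suc) ≡ coprime? 0 ℕ.+ sumOf (upTo n) coprime?
  shift = begin
    coprime? 0 ℕ.+ sumOf (upTo n) (coprime? ∘ suc)  ≡⟨ ℕ-Sum.sum-upTo-suc n coprime? ⟨
    sumOf (upTo (suc n)) coprime?                   ≡⟨ ℕ-Sum.sum-upTo-∷ʳ n coprime? ⟩
    sumOf (upTo n) coprime? ℕ.+ coprime? n          ≡⟨ ℕₚ.+-comm _ (coprime? n) ⟩
    coprime? n ℕ.+ sumOf (upTo n) coprime?          ≡⟨ cong (λ g → 𝟙 (g ℕₚ.≟ 1) ℕ.+ sumOf (upTo n) coprime?)
                                                            gcd[n,n]≡gcd[n,0] ⟩
    coprime? 0 ℕ.+ sumOf (upTo n) coprime?          ∎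
    where
    gcd[n,n]≡gcd[n,0] : gcd n n ≡ gcd n 0
    gcd[n,n]≡gcd[n,0] = ∣-antisym (gcd-greatest (gcd[m,n]∣m n n) (gcd n n ∣0))
                                  (gcd-greatest (gcd[m,n]∣m n 0) (gcd[m,n]∣m n 0))

  -- There are `e` multiples of `d` below `e * d`, and the indicator at 0 is 1.
  count-multiples : ∀ d e → e ℕ.* d ≡ n → sumOf (upTo n) (λ i → 𝟙 (d ∣? i)) ≡ e ℕ.* 𝟙 (d ∣? 0)
  count-multiples d e refl = begin
    sumOf (upTo (e ℕ.* d)) (λ i → 𝟙 (d ∣? i))
      ≡⟨ ℕ-Sum.sum-multiples e d {{ℕₚ.m*n≢0⇒n≢0 e}} _ (λ i → 𝟙-false (d ∣? i)) ⟩
    sumOf (upTo e) (λ j → 𝟙 (d ∣? j ℕ.* d))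
      ≡⟨ ℕ-Sum.sum-cong (upTo e) (λ j →
           ≡.trans (𝟙-true (d ∣? j ℕ.* d) (n∣m*n j)) (≡.sym (𝟙-true (d ∣? 0) (d ∣0)))) ⟩
    sumOf (upTo e) (const (𝟙 (d ∣? 0)))
      ≡⟨ ≡.trans (ℕ-Sum.sum-upTo-const e (𝟙 (d ∣? 0))) (ℕ-Sum.×≡* e _) ⟩
    e ℕ.* 𝟙 (d ∣? 0) ∎

^-pred-* : ∀ p {k} → 1 ≤ k → p ℕ.^ pred k ℕ.* p ≡ p ℕ.^ k
^-pred-* p {k} 1≤k = ≡.trans (ℕₚ.*-comm (p ℕ.^ pred k) p)
  (cong (p ℕ.^_) (ℕₚ.suc-pred k {{ℕ.>-nonZero 1≤k}}))

module _ {r} {p k : Fin r → ℕ} (p-prime : ∀ j → Prime (p j)) (p-inj : Injective _≡_ _≡_ p)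
         (1≤k : ∀ j → 1 ≤ k j) where

  -- Distinct primes are coprime, and by Euclid's lemma a prime dividing the product divides some
  -- `p j`, hence equals it.
  radicalFactorisation :
    RadicalFactorisation (∏[ j ∈ allFin r ] (p j ℕ.^ k j))
                         (∏[ j ∈ allFin r ] (p j ℕ.^ pred (k j))) (map p (allFin r))
  radicalFactorisation = record
    { coprime  = AllPairsₚ.map⁺ (AllPairs.map {S = Coprime on p}
                   (λ {i} {j} i≢j → distinct-primes-coprime (p-prime i) (p-prime j) (i≢j ∘ p-inj))
                   (allFin⁺ r))
    ; prime    = Allₚ.map⁺ (All.universal p-prime (allFin r))
    ; factor   = ≡.trans
        -- `sum-+` in the multiplicative monoid: the product of termwise products is the product of
        -- the two products.
        (≡.sym (ℕ-Product.sum-+ (allFin r) (λ j → p j ℕ.^ pred (k j)) p))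
        (ℕ-Product.sum-cong (allFin r) λ j →
          ^-pred-* (p j) (1≤k j))
    ; complete = λ {q} pq q∣N →
        let (j , q∣pᵏ) = prime-∣-product pq (allFin r) _ q∣N
        in ≡.subst (_∈ map p (allFin r)) (≡.sym (prime-∣⇒≡ pq (p-prime j) (prime-∣-^ pq (p j) (k j) q∣pᵏ)))
             (∈-map⁺ p (∈-allFin j))
    }

-- The totient formula for a single prime; the factors `* 1` are the empty tails of the products
-- over `Fin 1`.
totient-prime-^ : ∀ {p k} → Prime p → 1 ≤ k → totient (p ℕ.^ k) ≡ p ℕ.^ pred k ℕ.* (p ∸ 1)
totient-prime-^ {p} {k} p-prime 1≤k = begin
  totient (p ℕ.^ k)
    ≡⟨ cong totient (ℕₚ.*-identityʳ (p ℕ.^ k)) ⟨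
  totient (p ℕ.^ k ℕ.* 1)
    ≡⟨ totient-formula {{nz}}
         (radicalFactorisation {1} {const p} {const k} (const p-prime) (λ { {zero} {zero} _ → refl }) (const 1≤k)) ⟩
  p ℕ.^ pred k ℕ.* 1 ℕ.* ((p ∸ 𝟙 (p ∣? 0)) ℕ.* 1)
    ≡⟨ cong₂ ℕ._*_ (ℕₚ.*-identityʳ (p ℕ.^ pred k))
         (≡.trans (ℕₚ.*-identityʳ _) (cong (p ∸_) (𝟙-true (p ∣? 0) (p ∣0)))) ⟩
  p ℕ.^ pred k ℕ.* (p ∸ 1) ∎
  where
  open ≡-Reasoning
  nz : NonZero (p ℕ.^ k ℕ.* 1)
  nz = ℕₚ.m*n≢0 _ 1 {{ℕₚ.m^n≢0 p k {{prime⇒nonZero p-prime}}}}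

-- Summation over subsets of the prime indices.

-- The sum has exactly one nonzero term: I = {t : p t ∣ i}.
sum-subsets : ∀ {r} (p f g : Fin r → ℕ) i →
  sumOf (subsets r) (λ I →
    (∏[ t ∈ filter (λ t → t ∈? I) (allFin r) ] f t) ℕ.*
    (∏[ s ∈ filter (λ s → ¬? (s ∈? I)) (allFin r) ] g s) ℕ.*
    𝟙 (divisiblePrecisely? p I i))
  ≡ ∏[ j ∈ allFin r ] (if does (p j ∣? i) then f j else g j)
sum-subsets {r} p f g i = ≡.trans
  (ℕ-Sum.sum-cong (subsets r) λ I → cong (ℕ._* 𝟙 (divisiblePrecisely? p I i))
     (cong₂ ℕ._*_ (ℕ-Product.sum-filter (_∈? I) (allFin r) f)
                  (ℕ-Product.sum-filter (λ s → ¬? (s ∈? I)) (allFin r) g)))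
  (go r p f g)
  where
  open ≡-Reasoning

  -- Both products range over all indices, with the neutral factor 1 where the filter excludes an
  -- index, so that `zero` can be split off in the recursion on `r`.
  weight : ∀ {r} (f g : Fin r → ℕ) → Subset r → ℕ
  weight f g I =
    (∏[ t ∈ allFin _ ] (if does (t ∈? I) then f t else 1)) ℕ.*
    (∏[ s ∈ allFin _ ] (if not (does (s ∈? I)) then g s else 1))

  ∏-suc : ∀ {r} (f : Fin (suc r) → ℕ) → ∏[ j ∈ allFin (suc r) ] f j ≡ f zero ℕ.* (∏[ j ∈ allFin r ] f (suc j))
  ∏-suc f = cong (λ xs → f zero ℕ.* product xs) (≡.trans (map-tabulate suc f) (≡.sym (map-tabulate id (f ∘ suc))))

  weight-∷ : ∀ {r} (f g : Fin (suc r) → ℕ) b I →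
             weight f g (b Vec.∷ I) ≡ (if b then f zero else g zero) ℕ.* weight (f ∘ suc) (g ∘ suc) I
  weight-∷ f g b I = ≡.trans (cong₂ ℕ._*_
    (∏-suc (λ t → if does (t ∈? (b Vec.∷ I)) then f t else 1))
    (∏-suc (λ s → if not (does (s ∈? (b Vec.∷ I))) then g s else 1))) (rearrange b)
    where
    open +-*-Solver
    X = ∏[ t ∈ allFin _ ] (if does (t ∈? I) then f (suc t) else 1)
    Y = ∏[ s ∈ allFin _ ] (if not (does (s ∈? I)) then g (suc s) else 1)

    rearrange : ∀ b → (if does (zero ∈? (b Vec.∷ I)) then f zero else 1) ℕ.* X ℕ.*
                      ((if not (does (zero ∈? (b Vec.∷ I))) then g zero else 1) ℕ.* Y)
                    ≡ (if b then f zero else g zero) ℕ.* (X ℕ.* Y)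
    rearrange true  = solve 3 (λ a X Y → a :* X :* (con 1 :* Y) := a :* (X :* Y)) refl (f zero) X Y
    rearrange false = solve 3 (λ a X Y → con 1 :* X :* (a :* Y) := a :* (X :* Y)) refl (g zero) X Y

  𝟙-divisiblePrecisely-∷ : ∀ {r} (p : Fin (suc r) → ℕ) b I →
    𝟙 (divisiblePrecisely? p (b Vec.∷ I) i) ≡
    (if b then 𝟙 (p zero ∣? i) else 𝟙 (¬? (p zero ∣? i))) ℕ.* 𝟙 (divisiblePrecisely? (p ∘ suc) I i)
  𝟙-divisiblePrecisely-∷ p true I = ≡.trans
    (𝟙-⇔ (mk⇔ (λ (in∣ , out∤) → in∣ zero here , (λ t → in∣ (suc t) ∘ there)
                                 , λ s s∉I → out∤ (suc s) (s∉I ∘ drop-there))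
              (λ (∣i , in∣ , out∤) → (λ { zero _ → ∣i ; (suc t) t∈ → in∣ t (drop-there t∈) })
                                   , (λ { zero 0∉ → contradiction here 0∉ ; (suc s) s∉ → out∤ s (s∉ ∘ there) })))
         (divisiblePrecisely? p (true Vec.∷ I) i)
         ((p zero ∣? i) ×-dec divisiblePrecisely? (p ∘ suc) I i))
    (𝟙-×-dec (p zero ∣? i) (divisiblePrecisely? (p ∘ suc) I i))
  𝟙-divisiblePrecisely-∷ p false I = ≡.trans
    (𝟙-⇔ (mk⇔ (λ (in∣ , out∤) → out∤ zero (λ ()) , (λ t → in∣ (suc t) ∘ there)
                                 , λ s s∉I → out∤ (suc s) (s∉I ∘ drop-there))
              (λ (∤i , in∣ , out∤) → (λ { zero () ; (suc t) t∈ → in∣ t (drop-there t∈) })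
                                   , (λ { zero _ → ∤i ; (suc s) s∉ → out∤ s (s∉ ∘ there) })))
         (divisiblePrecisely? p (false Vec.∷ I) i)
         (¬? (p zero ∣? i) ×-dec divisiblePrecisely? (p ∘ suc) I i))
    (𝟙-×-dec (¬? (p zero ∣? i)) (divisiblePrecisely? (p ∘ suc) I i))

  -- Subsets are split by whether they contain `zero`. Both halves are multiples of the same sum `S`
  -- over the remaining indices, with coefficients f₀ [p₀ ∣ i] and g₀ [p₀ ∤ i]; only the one
  -- matching the divisibility of `i` survives.
  go : ∀ r (p f g : Fin r → ℕ) →
       sumOf (subsets r) (λ I → weight f g I ℕ.* 𝟙 (divisiblePrecisely? p I i)) ≡
       ∏[ j ∈ allFin r ] (if does (p j ∣? i) then f j else g j)
  go zero    p f g = refl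
  go (suc r) p f g = begin
    sumOf (subsets (suc r)) term
      ≡⟨ ℕ-Sum.sum-++ (map (false Vec.∷_) (subsets r)) (map (true Vec.∷_) (subsets r)) term ⟩
    sumOf (map (false Vec.∷_) (subsets r)) term ℕ.+ sumOf (map (true Vec.∷_) (subsets r)) term
      ≡⟨ cong₂ ℕ._+_ (half false) (half true) ⟩
    c false ℕ.* S ℕ.+ c true ℕ.* S
      ≡⟨ collect ⟩
    (if does (p zero ∣? i) then f zero else g zero) ℕ.* S
      ≡⟨ cong ((if does (p zero ∣? i) then f zero else g zero) ℕ.*_) (go r (p ∘ suc) (f ∘ suc) (g ∘ suc)) ⟩
    (if does (p zero ∣? i) then f zero else g zero) ℕ.*
    (∏[ j ∈ allFin r ] (if does (p (suc j) ∣? i) then f (suc j) else g (suc j)))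
      ≡⟨ ∏-suc (λ j → if does (p j ∣? i) then f j else g j) ⟨
    ∏[ j ∈ allFin (suc r) ] (if does (p j ∣? i) then f j else g j) ∎
    where
    term : Subset (suc r) → ℕ
    term I = weight f g I ℕ.* 𝟙 (divisiblePrecisely? p I i)

    term′ : Subset r → ℕ
    term′ I = weight (f ∘ suc) (g ∘ suc) I ℕ.* 𝟙 (divisiblePrecisely? (p ∘ suc) I i)

    S = sumOf (subsets r) term′

    δ : Bool → ℕ
    δ b = if b then 𝟙 (p zero ∣? i) else 𝟙 (¬? (p zero ∣? i))

    c : Bool → ℕ
    c b = (if b then f zero else g zero) ℕ.* δ b

    half : ∀ b → sumOf (map (b Vec.∷_) (subsets r)) term ≡ c b ℕ.* S
    half b = begin
      sumOf (map (b Vec.∷_) (subsets r)) term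
        ≡⟨ ℕ-Sum.sum-map (b Vec.∷_) (subsets r) term ⟩
      sumOf (subsets r) (λ I → term (b Vec.∷ I))
        ≡⟨ ℕ-Sum.sum-cong (subsets r) (λ I → ≡.trans
             (cong₂ ℕ._*_ (weight-∷ f g b I) (𝟙-divisiblePrecisely-∷ p b I))
             (ℕₚ.[m*n]*[o*p]≡[m*o]*[n*p] (if b then f zero else g zero) _ (δ b) _)) ⟩
      sumOf (subsets r) (λ I → c b ℕ.* term′ I)
        ≡⟨ ℕ-Sum.sum-*ˡ (subsets r) (c b) term′ ⟩
      c b ℕ.* S ∎

    collect : c false ℕ.* S ℕ.+ c true ℕ.* S ≡ (if does (p zero ∣? i) then f zero else g zero) ℕ.* S
    collect with does (p zero ∣? i)
    ... | true  = solve 3 (λ x y S → y :* con 0 :* S :+ x :* con 1 :* S := x :* S) refl (f zero) (g zero) S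
      where open +-*-Solver
    ... | false = solve 3 (λ x y S → y :* con 1 :* S :+ x :* con 0 :* S := y :* S) refl (f zero) (g zero) S
      where open +-*-Solver

-- Sums over factor pairs.

sum-positivesBelow : ∀ m {f} → f 0 ≡ 0 → sumOf (positivesBelow (suc m)) f ≡ sumOf (upTo (suc m)) f
-- `upTo (suc m)` unfolds to `0` followed by `positivesBelow (suc m)`, so only the term at 0 has to
-- be accounted for.
sum-positivesBelow m {f} f0≡0 = cong (ℕ._+ sumOf (positivesBelow (suc m)) f) (≡.sym f0≡0)

-- Substitution u = v e. The range of u is first lengthened from m + 1 to (m + 1) e, where the added
-- terms vanish, so that v ends up with the same range as n; this makes the later exchange of n and
-- v a mere swap of two sums.
sum-factorPairs-multiples : ∀ m .{{_ : NonZero m}} e .{{_ : NonZero e}} (c : ℕ → ℕ → ℕ) →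
  sumOf (factorPairs m) (λ (n , u) → c n u ℕ.* 𝟙 (e ∣? u)) ≡
  sumOf (upTo (suc m)) (λ n → sumOf (upTo (suc m)) (λ v → 𝟙 (n ℕ.* (v ℕ.* e) ℕₚ.≟ m) ℕ.* c n (v ℕ.* e)))
sum-factorPairs-multiples m@(suc m-1) e@(suc e-1) c = begin
  sumOf (factorPairs m) (λ (n , u) → c n u ℕ.* 𝟙 (e ∣? u))
    ≡⟨ ℕ-Sum.sum-filter-𝟙 (λ (n , u) → n ℕ.* u ℕₚ.≟ m) (cartesianProduct P P) (λ (n , u) → c n u ℕ.* 𝟙 (e ∣? u)) ⟩
  sumOf (cartesianProduct P P)
    (λ (n , u) → 𝟙 (n ℕ.* u ℕₚ.≟ m) ℕ-Sum.× (c n u ℕ.* 𝟙 (e ∣? u)))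
    ≡⟨ ℕ-Sum.sum-cong (cartesianProduct P P)
         (λ (n , u) → ℕ-Sum.×≡* (𝟙 (n ℕ.* u ℕₚ.≟ m)) _) ⟩
  sumOf (cartesianProduct P P) (λ (n , u) → H n u)
    ≡⟨ ℕ-Sum.sum-cartesianProduct P P (λ (n , u) → H n u) ⟩
  sumOf P (λ n → sumOf P (H n))
    ≡⟨ ℕ-Sum.sum-cong P (λ n → sum-positivesBelow m (H-zeroʳ n)) ⟩
  sumOf P (λ n → sumOf (upTo (suc m)) (H n))
    ≡⟨ sum-positivesBelow m (ℕ-Sum.sum-zero (upTo (suc m))) ⟩
  sumOf (upTo (suc m)) (λ n → sumOf (upTo (suc m)) (H n))
    ≡⟨ ℕ-Sum.sum-cong (upTo (suc m)) inner ⟩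
  sumOf (upTo (suc m)) (λ n → sumOf (upTo (suc m)) (λ v → 𝟙 (n ℕ.* (v ℕ.* e) ℕₚ.≟ m) ℕ.* c n (v ℕ.* e))) ∎
  where
  open ≡-Reasoning

  P = positivesBelow (suc m)

  H : ℕ → ℕ → ℕ
  H n u = 𝟙 (n ℕ.* u ℕₚ.≟ m) ℕ.* (c n u ℕ.* 𝟙 (e ∣? u))

  H-zero : ∀ n u → n ℕ.* u ≢ m → H n u ≡ 0
  H-zero n u nu≢m = cong (ℕ._* (c n u ℕ.* 𝟙 (e ∣? u))) (𝟙-false (n ℕ.* u ℕₚ.≟ m) nu≢m)

  H-zeroʳ : ∀ n → H n 0 ≡ 0
  H-zeroʳ n = H-zero n 0 λ n*0≡m → contradiction (≡.trans (≡.sym (ℕₚ.*-zeroʳ n)) n*0≡m) λ ()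

  -- For n = 0 the product n u is 0, which is not `m`; for positive n it is at least u, which
  -- exceeds `m`.
  H-zero-> : ∀ n i → H n (suc m ℕ.+ i) ≡ 0
  H-zero-> zero    i = refl
  H-zero-> (suc n) i = H-zero (suc n) (suc m ℕ.+ i)
    (ℕₚ.<⇒≢ (ℕₚ.≤-trans (ℕₚ.m≤m+n (suc m) i) (ℕₚ.m≤m+n (suc m ℕ.+ i) _)) ∘ ≡.sym)

  inner : ∀ n → sumOf (upTo (suc m)) (H n) ≡
                sumOf (upTo (suc m)) (λ v → 𝟙 (n ℕ.* (v ℕ.* e) ℕₚ.≟ m) ℕ.* c n (v ℕ.* e))
  inner n = begin
    sumOf (upTo (suc m)) (H n)
      ≡⟨ ℕₚ.+-identityʳ _ ⟨
    sumOf (upTo (suc m)) (H n) ℕ.+ 0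
      ≡⟨ cong (sumOf (upTo (suc m)) (H n) ℕ.+_)
           (≡.trans (ℕ-Sum.sum-cong (upTo (suc m ℕ.* e-1)) (H-zero-> n)) (ℕ-Sum.sum-zero (upTo (suc m ℕ.* e-1)))) ⟨
    sumOf (upTo (suc m)) (H n) ℕ.+ sumOf (upTo (suc m ℕ.* e-1)) (H n ∘ (suc m ℕ.+_))
      ≡⟨ ℕ-Sum.sum-upTo-+ (suc m) (suc m ℕ.* e-1) (H n) ⟨
    sumOf (upTo (suc m ℕ.+ suc m ℕ.* e-1)) (H n)
      ≡⟨ cong (λ x → sumOf (upTo x) (H n)) (ℕₚ.*-suc (suc m) e-1) ⟨
    sumOf (upTo (suc m ℕ.* e)) (H n)
      ≡⟨ ℕ-Sum.sum-multiples (suc m) e (H n) (λ i e∤i →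
           ≡.trans (cong (λ x → 𝟙 (n ℕ.* i ℕₚ.≟ m) ℕ.* (c n i ℕ.* x)) (𝟙-false (e ∣? i) e∤i))
           (≡.trans (cong (𝟙 (n ℕ.* i ℕₚ.≟ m) ℕ.*_) (ℕₚ.*-zeroʳ (c n i))) (ℕₚ.*-zeroʳ (𝟙 (n ℕ.* i ℕₚ.≟ m))))) ⟩
    sumOf (upTo (suc m)) (λ v → H n (v ℕ.* e))
      ≡⟨ ℕ-Sum.sum-cong (upTo (suc m)) (λ v → cong (𝟙 (n ℕ.* (v ℕ.* e) ℕₚ.≟ m) ℕ.*_)
           (≡.trans (cong (c n (v ℕ.* e) ℕ.*_) (𝟙-true (e ∣? v ℕ.* e) (n∣m*n v))) (ℕₚ.*-identityʳ _))) ⟩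
    sumOf (upTo (suc m)) (λ v → 𝟙 (n ℕ.* (v ℕ.* e) ℕₚ.≟ m) ℕ.* c n (v ℕ.* e)) ∎

-- If e ∣ u then n * u ≡ m says n * v * e ≡ m with v = u / e, which is symmetric in n and v.
sum-factorPairs-exchange : ∀ m e .{{_ : NonZero e}} →
  sumOf (factorPairs m) (λ (n , u) → u ℕ.* 𝟙 (e ∣? u)) ≡
  sumOf (factorPairs m) (λ (n , u) → e ℕ.* n ℕ.* 𝟙 (e ∣? u))
sum-factorPairs-exchange zero      e = refl
sum-factorPairs-exchange m@(suc _) e = begin
  sumOf (factorPairs m) (λ (n , u) → u ℕ.* 𝟙 (e ∣? u))
    ≡⟨ sum-factorPairs-multiples m e (λ n u → u) ⟩
  sumOf R (λ n → sumOf R (λ v → 𝟙 (n ℕ.* (v ℕ.* e) ℕₚ.≟ m) ℕ.* (v ℕ.* e)))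
    ≡⟨ ℕ-Sum.sum-swap R R (λ n v → 𝟙 (n ℕ.* (v ℕ.* e) ℕₚ.≟ m) ℕ.* (v ℕ.* e)) ⟩
  sumOf R (λ v → sumOf R (λ n → 𝟙 (n ℕ.* (v ℕ.* e) ℕₚ.≟ m) ℕ.* (v ℕ.* e)))
    ≡⟨ ℕ-Sum.sum-cong R (λ v → ℕ-Sum.sum-cong R λ n →
         cong₂ (λ x y → 𝟙 (x ℕₚ.≟ m) ℕ.* y)
           (solve 3 (λ n v e → n :* (v :* e) := v :* (n :* e)) refl n v e) (ℕₚ.*-comm v e)) ⟩
  sumOf R (λ v → sumOf R (λ n → 𝟙 (v ℕ.* (n ℕ.* e) ℕₚ.≟ m) ℕ.* (e ℕ.* v)))
    ≡⟨ sum-factorPairs-multiples m e (λ n u → e ℕ.* n) ⟨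
  sumOf (factorPairs m) (λ (n , u) → e ℕ.* n ℕ.* 𝟙 (e ∣? u)) ∎
  where
  open ≡-Reasoning
  open +-*-Solver
  R = upTo (suc m)

-- Roots of unity and orthogonality of characters.

module _ {c ℓ₁ ℓ₂} (K : HeytingField c ℓ₁ ℓ₂) where

  open Sums K using (_×_; _^_; σ₁; κ₁; IsPrimitiveRoot)
  private
    R = HeytingCommutativeRing.commutativeRing (HeytingField.heytingCommutativeRing K)
  open CommutativeRing R hiding (zero) renaming (refl to ≈-refl)
  open HeytingField K using (_#_; #⇒invertible)
  open MonoidMult +-commutativeMonoid using (×-congʳ; ×-congˡ; ×-assocˡ; ×-homo-1; ×-homo-+)
  open SemiringExp semiring using (^-assocʳ; ^-homo-*; ^-congˡ; ^-congʳ)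
  open RingProperties ring using (-‿distribˡ-*)
  open GroupProperties +-group using (∙-cancelˡ)
  open SetoidReasoning setoid
  private module S = FiniteSum +-commutativeMonoid

  1^n≈1 : ∀ n → 1# ^ n ≈ 1#
  1^n≈1 zero    = ≈-refl
  1^n≈1 (suc n) = trans (*-identityˡ _) (1^n≈1 n)

  sum-*ˡ : ∀ {a} {A : Set a} (xs : List A) x f → S.sumOf xs (λ y → x * f y) ≈ x * S.sumOf xs f
  sum-*ˡ []       x f = sym (zeroʳ x)
  sum-*ˡ (y ∷ xs) x f = trans (+-congˡ (sum-*ˡ xs x f)) (sym (distribˡ x _ _))

  -- Multiplication by ζ raises every power by one and ζ^e = 1 closes the cycle, so the sum is fixed
  -- by ζ. Apartness makes ζ - 1 invertible, and the sum vanishes.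
  #1⇒geometric-sum≈0 : ∀ {ζ e} → ζ # 1# → ζ ^ e ≈ 1# → S.sumOf (upTo e) (ζ ^_) ≈ 0#
  #1⇒geometric-sum≈0 {ζ} {e} ζ#1 ζᵉ≈1 = begin
    s                     ≈⟨ *-identityˡ s ⟨
    1# * s                ≈⟨ *-congʳ (proj₁ (proj₂ inv)) ⟨
    i * (ζ - 1#) * s      ≈⟨ *-assoc i (ζ - 1#) s ⟩
    i * ((ζ - 1#) * s)    ≈⟨ *-congˡ [ζ-1]s≈0 ⟩
    i * 0#                ≈⟨ zeroʳ i ⟩
    0#                    ∎
    where
    s = S.sumOf (upTo e) (ζ ^_)
    inv = #⇒invertible ζ#1
    i = proj₁ inv

    -- Both `1# + ζ * s` and `s + ζ ^ e` are the sum of the first e + 1 powers of ζ.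
    ζs≈s : ζ * s ≈ s
    ζs≈s = ∙-cancelˡ 1# _ _ (begin
      1# + ζ * s                             ≈⟨ +-congˡ (sum-*ˡ (upTo e) ζ (ζ ^_)) ⟨
      1# + S.sumOf (upTo e) (λ j → ζ ^ suc j)  ≈⟨ S.sum-upTo-suc e (ζ ^_) ⟨
      S.sumOf (upTo (suc e)) (ζ ^_)          ≈⟨ S.sum-upTo-∷ʳ e (ζ ^_) ⟩
      s + ζ ^ e                              ≈⟨ +-congˡ ζᵉ≈1 ⟩
      s + 1#                                 ≈⟨ +-comm s 1# ⟩
      1# + s                                 ∎)

    [ζ-1]s≈0 : (ζ - 1#) * s ≈ 0#
    [ζ-1]s≈0 = begin
      (ζ - 1#) * s          ≈⟨ distribʳ s ζ (- 1#) ⟩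
      ζ * s + - 1# * s      ≈⟨ +-cong ζs≈s (trans (sym (-‿distribˡ-* 1# s)) (-‿cong (*-identityˡ s))) ⟩
      s - s                 ≈⟨ -‿inverseʳ s ⟩
      0#                    ∎

  module _ {N : ℕ} .{{_ : NonZero N}} {η : Carrier} (η-root : IsPrimitiveRoot N η) where

    η^[Nx]≈1 : ∀ x → η ^ (N ℕ.* x) ≈ 1#
    η^[Nx]≈1 x = begin
      η ^ (N ℕ.* x)  ≈⟨ ^-assocʳ η N x ⟨
      (η ^ N) ^ x    ≈⟨ ^-congˡ x (proj₁ η-root) ⟩
      1# ^ x         ≈⟨ 1^n≈1 x ⟩
      1#             ∎

    -- `IsPrimitiveRoot` gives apartness from `1#` only for exponents strictly between 0 and `N`, so
    -- exponents have to be brought below `N`.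
    η^%≈ : ∀ x → η ^ (x % N) ≈ η ^ x
    η^%≈ x = begin
      η ^ (x % N)                              ≈⟨ *-identityʳ _ ⟨
      η ^ (x % N) * 1#                         ≈⟨ *-congˡ (η^[Nx]≈1 (x / N)) ⟨
      η ^ (x % N) * η ^ (N ℕ.* (x / N))        ≈⟨ ^-homo-* η (x % N) (N ℕ.* (x / N)) ⟨
      η ^ (x % N ℕ.+ N ℕ.* (x / N))            ≡⟨ cong (λ y → η ^ (x % N ℕ.+ y)) (ℕₚ.*-comm N (x / N)) ⟩
      η ^ (x % N ℕ.+ (x / N) ℕ.* N)            ≡⟨ cong (η ^_) (m≡m%n+[m/n]*n x N) ⟨
      η ^ x                                    ∎

    -- The terms are the powers of ζ = η^(d u), and ζ^e = 1. If e ∣ u they are all 1; otherwise e d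
    -- = N does not divide d u, so ζ is apart from 1 and the geometric sum vanishes.
    orthogonality : ∀ d e → e ℕ.* d ≡ N → ∀ u →
                    S.sumOf (upTo e) (λ j → η ^ (j ℕ.* d ℕ.* u)) ≈ (e ℕ.* 𝟙 (e ∣? u)) × 1#
    orthogonality d e refl u with e ∣? u
    ... | yes (divides q refl) = begin
      S.sumOf (upTo e) (λ j → η ^ (j ℕ.* d ℕ.* (q ℕ.* e)))
        ≈⟨ S.sum-cong (upTo e) (λ j → trans
             (^-congʳ η (solve 4 (λ j d q e → j :* d :* (q :* e) := e :* d :* (j :* q)) refl j d q e))
             (η^[Nx]≈1 (j ℕ.* q))) ⟩
      S.sumOf (upTo e) (const 1#)   ≈⟨ S.sum-upTo-const e 1# ⟩
      e × 1#                        ≈⟨ ×-congˡ (ℕₚ.*-identityʳ e) ⟨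
      (e ℕ.* 1) × 1#                ∎
      where open +-*-Solver
    ... | no e∤u = begin
      S.sumOf (upTo e) (λ j → η ^ (j ℕ.* d ℕ.* u))
        ≈⟨ S.sum-cong (upTo e) (λ j → begin
             η ^ (j ℕ.* d ℕ.* u)      ≡⟨ cong (η ^_) (solve 3 (λ j d u → j :* d :* u := d :* u :* j) refl j d u) ⟩
             η ^ (d ℕ.* u ℕ.* j)      ≈⟨ ^-assocʳ η (d ℕ.* u) j ⟨
             (η ^ (d ℕ.* u)) ^ j      ≈⟨ ^-congˡ j (η^%≈ (d ℕ.* u)) ⟨
             (η ^ (d ℕ.* u % N)) ^ j  ∎) ⟩
      S.sumOf (upTo e) ((η ^ (d ℕ.* u % N)) ^_)
        ≈⟨ #1⇒geometric-sum≈0 {e = e} (proj₂ η-root (d ℕ.* u % N) (ℕₚ.n≢0⇒n>0 r≢0) (m%n<n (d ℕ.* u) N)) ζᵉ≈1 ⟩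
      0#
        ≈⟨ ×-congˡ (ℕₚ.*-zeroʳ e) ⟨
      (e ℕ.* 0) × 1# ∎
      where
      open +-*-Solver

      r≢0 : d ℕ.* u % N ≢ 0
      r≢0 r≡0 = e∤u (*-cancelˡ-∣ d {{ℕₚ.m*n≢0⇒n≢0 e}}
        (≡.subst (_∣ d ℕ.* u) (ℕₚ.*-comm e d) (m%n≡0⇒n∣m (d ℕ.* u) N r≡0)))

      ζᵉ≈1 : (η ^ (d ℕ.* u % N)) ^ e ≈ 1#
      ζᵉ≈1 = begin
        (η ^ (d ℕ.* u % N)) ^ e   ≈⟨ ^-congˡ e (η^%≈ (d ℕ.* u)) ⟩
        (η ^ (d ℕ.* u)) ^ e       ≈⟨ ^-assocʳ η (d ℕ.* u) e ⟩
        η ^ (d ℕ.* u ℕ.* e)       ≡⟨ cong (η ^_) (solve 3 (λ d u e → d :* u :* e := e :* d :* u) refl d u e) ⟩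
        η ^ (N ℕ.* u)             ≈⟨ η^[Nx]≈1 u ⟩
        1#                        ∎

    -- The sieve applied to `σ₁` and `κ₁`.

    module _ (m : ℕ) where

      -- σ₁ and κ₁ are the cases w = proj₂ and w = proj₁.
      twisted : (ℕ Prod.× ℕ → ℕ) → ℕ → Carrier
      twisted w a = S.sumOf (factorPairs m) (λ x → w x × η ^ (a ℕ.* proj₂ x))

      -- Once the sums over `i` and over factor pairs are exchanged, orthogonality evaluates the
      -- inner one. The result is a natural multiple of `1#`, so comparing `σ₁` with `κ₁` becomes an
      -- identity in `ℕ`.
      sum-twisted : ∀ w d e → e ℕ.* d ≡ N →
        S.sumOf (upTo N) (λ i → 𝟙 (d ∣? i) × twisted w i) ≈
        (e ℕ.* sumOf (factorPairs m) (λ x → w x ℕ.* 𝟙 (e ∣? proj₂ x))) × 1#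
      sum-twisted w d e refl = begin
        S.sumOf (upTo (e ℕ.* d)) (λ i → 𝟙 (d ∣? i) × twisted w i)
          ≈⟨ S.sum-multiples e d {{ℕₚ.m*n≢0⇒n≢0 e}} _ (λ i d∤i → ×-congˡ (𝟙-false (d ∣? i) d∤i)) ⟩
        S.sumOf (upTo e) (λ j → 𝟙 (d ∣? j ℕ.* d) × twisted w (j ℕ.* d))
          ≈⟨ S.sum-cong (upTo e) (λ j → trans (×-congˡ (𝟙-true (d ∣? j ℕ.* d) (n∣m*n j))) (×-homo-1 _)) ⟩
        S.sumOf (upTo e) (λ j → twisted w (j ℕ.* d))
          ≈⟨ S.sum-swap (upTo e) (factorPairs m) (λ j x → w x × η ^ (j ℕ.* d ℕ.* proj₂ x)) ⟩
        S.sumOf (factorPairs m) (λ x → S.sumOf (upTo e) (λ j → w x × η ^ (j ℕ.* d ℕ.* proj₂ x)))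
          ≈⟨ S.sum-cong (factorPairs m) (λ x → begin
               S.sumOf (upTo e) (λ j → w x × η ^ (j ℕ.* d ℕ.* proj₂ x))
                 ≈⟨ S.sum-× (upTo e) (w x) _ ⟩
               w x × S.sumOf (upTo e) (λ j → η ^ (j ℕ.* d ℕ.* proj₂ x))
                 ≈⟨ ×-congʳ (w x) (orthogonality d e refl (proj₂ x)) ⟩
               w x × (e ℕ.* 𝟙 (e ∣? proj₂ x)) × 1#
                 ≈⟨ ×-assocˡ 1# (w x) _ ⟩
               (w x ℕ.* (e ℕ.* 𝟙 (e ∣? proj₂ x))) × 1#
                 ≡⟨ cong (_× 1#)
                      (solve 3 (λ w e t → w :* (e :* t) := e :* (w :* t)) refl (w x) e (𝟙 (e ∣? proj₂ x))) ⟩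
               (e ℕ.* (w x ℕ.* 𝟙 (e ∣? proj₂ x))) × 1# ∎) ⟩
        S.sumOf (factorPairs m) (λ x → (e ℕ.* (w x ℕ.* 𝟙 (e ∣? proj₂ x))) × 1#)
          ≈⟨ S.sum-×ˡ (factorPairs m) _ 1# ⟩
        sumOf (factorPairs m) (λ x → e ℕ.* (w x ℕ.* 𝟙 (e ∣? proj₂ x))) × 1#
          ≈⟨ ×-congˡ (ℕ-Sum.sum-*ˡ (factorPairs m) e _) ⟩
        (e ℕ.* sumOf (factorPairs m) (λ x → w x ℕ.* 𝟙 (e ∣? proj₂ x))) × 1# ∎
        where open +-*-Solver

      ∑σ ∑κ : (ℕ → ℕ) → Carrier
      ∑σ f = S.sumOf (upTo N) (λ i → f i × σ₁ η i m)
      ∑κ f = S.sumOf (upTo N) (λ i → f i × κ₁ η i m)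

      -- The `base` hypothesis of the sieve. Orthogonality gives one factor `e` on either side;
      -- exchanging the factors of the pairs supplies the further `e` in front of `κ₁`.
      σ-κ-multiples : ∀ d e → e ℕ.* d ≡ N → ∑σ (λ i → 𝟙 (d ∣? i)) ≈ ∑κ (λ i → e ℕ.* 𝟙 (d ∣? i))
      σ-κ-multiples d e e*d≡N = begin
        ∑σ (λ i → 𝟙 (d ∣? i))
          ≈⟨ sum-twisted proj₂ d e e*d≡N ⟩
        (e ℕ.* sumOf (factorPairs m) (λ (n , u) → u ℕ.* 𝟙 (e ∣? u))) × 1#
          ≈⟨ ×-congˡ (cong (e ℕ.*_) exchange) ⟩
        (e ℕ.* (e ℕ.* sumOf (factorPairs m) (λ (n , u) → n ℕ.* 𝟙 (e ∣? u)))) × 1#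
          ≈⟨ ×-assocˡ 1# e _ ⟨
        e × (e ℕ.* sumOf (factorPairs m) (λ (n , u) → n ℕ.* 𝟙 (e ∣? u))) × 1#
          ≈⟨ ×-congʳ e (sum-twisted proj₁ d e e*d≡N) ⟨
        e × ∑κ (λ i → 𝟙 (d ∣? i))
          ≈⟨ S.sum-× (upTo N) e _ ⟨
        S.sumOf (upTo N) (λ i → e × 𝟙 (d ∣? i) × κ₁ η i m)
          ≈⟨ S.sum-cong (upTo N) (λ i → ×-assocˡ _ e (𝟙 (d ∣? i))) ⟩
        ∑κ (λ i → e ℕ.* 𝟙 (d ∣? i)) ∎
        where
        exchange : sumOf (factorPairs m) (λ (n , u) → u ℕ.* 𝟙 (e ∣? u)) ≡
                   e ℕ.* sumOf (factorPairs m) (λ (n , u) → n ℕ.* 𝟙 (e ∣? u))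
        exchange = ≡.trans
          (sum-factorPairs-exchange m e {{ℕₚ.m*n≢0⇒m≢0 e {d} {{≡.subst NonZero (≡.sym e*d≡N) it}}}})
          (≡.trans (ℕ-Sum.sum-cong (factorPairs m) (λ (n , u) → ℕₚ.*-assoc e n _))
                   (ℕ-Sum.sum-*ˡ (factorPairs m) e _))

      -- As η^0 = 1, both are natural multiples of `1#`, namely by the sums of the first and of the
      -- second entries; the exchange identity with e = 1 equates these.
      κ₁-0≈σ₁-0 : κ₁ η 0 m ≈ σ₁ η 0 m
      κ₁-0≈σ₁-0 = begin
        κ₁ η 0 m
          ≈⟨ S.sum-×ˡ (factorPairs m) proj₁ 1# ⟩
        sumOf (factorPairs m) proj₁ × 1#
          ≡⟨ cong (_× 1#) swap ⟨
        sumOf (factorPairs m) proj₂ × 1#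
          ≈⟨ S.sum-×ˡ (factorPairs m) proj₂ 1# ⟨
        σ₁ η 0 m ∎
        where
        *𝟙-1∣ : ∀ x u → x ℕ.* 𝟙 (1 ∣? u) ≡ x
        *𝟙-1∣ x u = ≡.trans (cong (x ℕ.*_) (𝟙-true (1 ∣? u) (1∣ u))) (ℕₚ.*-identityʳ x)

        swap : sumOf (factorPairs m) proj₂ ≡ sumOf (factorPairs m) proj₁
        swap = ≡.trans (ℕ-Sum.sum-cong (factorPairs m) (λ (n , u) → ≡.sym (*𝟙-1∣ u u)))
          (≡.trans (sum-factorPairs-exchange m 1)
            (ℕ-Sum.sum-cong (factorPairs m) (λ (n , u) → ≡.trans (*𝟙-1∣ (1 ℕ.* n) u) (ℕₚ.*-identityˡ n))))

      σ-κ-sieve : ∀ {e L} → RadicalFactorisation N e L →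
                  ∑σ (λ i → 𝟙 (gcd N i ℕₚ.≟ 1)) ≈ ∑κ (λ i → e ℕ.* deficient L i)
      σ-κ-sieve {e} {L} rad = trans
        (S.sum-cong (upTo N) λ i → ×-congˡ (≡.sym (avoiding≡𝟙-coprime i)))
        (sieve +-commutativeMonoid ∙-cancelˡ ∑σ ∑κ
          (λ f≡g → S.sum-cong (upTo N) λ i → ×-congˡ (f≡g i))
          (λ f≡g → S.sum-cong (upTo N) λ i → ×-congˡ (f≡g i))
          (λ f g → trans (S.sum-cong (upTo N) λ i → ×-homo-+ _ (f i) (g i)) (S.sum-+ (upTo N) _ _))
          (λ f g → trans (S.sum-cong (upTo N) λ i → ×-homo-+ _ (f i) (g i)) (S.sum-+ (upTo N) _ _))
          N σ-κ-multiples coprime prime e factor)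
        where open RadicalFactorisation rad

-- The coefficients of the right-hand side and the final assembly.

deficient-product : ∀ {r} {p k : Fin r → ℕ} → (∀ j → Prime (p j)) → (∀ j → 1 ≤ k j) → ∀ i →
  (∏[ j ∈ allFin r ] (p j ℕ.^ pred (k j))) ℕ.* deficient (map p (allFin r)) i ≡
  ∏[ j ∈ allFin r ] (if does (p j ∣? i) then totient (p j ℕ.^ k j) else p j ℕ.^ k j)
deficient-product {r} {p} {k} p-prime 1≤k i = begin
  (∏[ j ∈ allFin r ] (p j ℕ.^ pred (k j))) ℕ.* deficient (map p (allFin r)) i
    ≡⟨ cong ((∏[ j ∈ allFin r ] (p j ℕ.^ pred (k j))) ℕ.*_) (ℕ-Product.sum-map p (allFin r) (λ q → q ∸ 𝟙 (q ∣? i))) ⟩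
  (∏[ j ∈ allFin r ] (p j ℕ.^ pred (k j))) ℕ.* (∏[ j ∈ allFin r ] (p j ∸ 𝟙 (p j ∣? i)))
    ≡⟨ ℕ-Product.sum-+ (allFin r) _ _ ⟨
  (∏[ j ∈ allFin r ] (p j ℕ.^ pred (k j) ℕ.* (p j ∸ 𝟙 (p j ∣? i))))
    ≡⟨ ℕ-Product.sum-cong (allFin r) factor ⟩
  (∏[ j ∈ allFin r ] (if does (p j ∣? i) then totient (p j ℕ.^ k j) else p j ℕ.^ k j)) ∎
  where
  open ≡-Reasoning
  -- If p ∣ i this is p^(k-1) (p - 1) = φ(p^k), otherwise p^(k-1) p = p^k.
  factor : ∀ j → p j ℕ.^ pred (k j) ℕ.* (p j ∸ 𝟙 (p j ∣? i)) ≡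
                 (if does (p j ∣? i) then totient (p j ℕ.^ k j) else p j ℕ.^ k j)
  factor j with does (p j ∣? i)
  ... | true  = ≡.sym (totient-prime-^ (p-prime j) (1≤k j))
  ... | false = ^-pred-* (p j) (1≤k j)

theorem7p2 :
    ∀ {c ℓ₁ ℓ₂} (K : HeytingField c ℓ₁ ℓ₂) (let open Sums K)
      (N r : ℕ) (p k : Fin r → ℕ) →
      2 ≤ N →
      (∀ j → Prime (p j)) →
      Injective _≡_ _≡_ p →
      (∀ j → 1 ≤ k j) →
      N ≡ (∏[ j ∈ allFin r ] (p j ℕ.^ k j)) →
      (η : Carrier) → IsPrimitiveRoot N η →
      (m : ℕ) →
      ( (∑[ i ∈ coprimesBelow N ] (σ₁ η i m)) - (totient N × σ₁ η 0 m) )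
      ≈
      (∑[ I ∈ subsets r ]
        ( ( (∏[ t ∈ filter (λ t → t ∈? I) (allFin r) ] totient (p t ℕ.^ k t))
            ℕ.*
            (∏[ s ∈ filter (λ s → ¬? (s ∈? I)) (allFin r) ] (p s ℕ.^ k s)) )
          ×
          (∑[ i ∈ filter (divisiblePrecisely? p I) (positivesBelow N) ] (κ₁ η i m)) ))
theorem7p2 K N@(suc (suc _)) r p k (s≤s (s≤s _)) p-prime p-inj 1≤k N≡∏ η η-root m = begin
  S.sumOf (coprimesBelow N) σ - totient N × σ 0
    ≈⟨ +-congʳ coprime-sum ⟩
  totient N × σ 0 + rhs - totient N × σ 0
    ≈⟨ xyx⁻¹≈y (totient N × σ 0) rhs ⟩
  rhs
    ≈⟨ subset-sum ⟩
  S.sumOf (subsets r) (λ I → C I × S.sumOf (filter (divisiblePrecisely? p I) (positivesBelow N)) κ) ∎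
  where
  open Sums K using (_×_; σ₁; κ₁)
  R = HeytingCommutativeRing.commutativeRing (HeytingField.heytingCommutativeRing K)
  open CommutativeRing R hiding (zero) renaming (refl to ≈-refl)
  open MonoidMult +-commutativeMonoid using (×-congʳ; ×-congˡ; ×-assocˡ; ×-cong)
  open AbelianGroupProperties +-abelianGroup using (xyx⁻¹≈y)
  open SetoidReasoning setoid
  module S = FiniteSum +-commutativeMonoid

  L = map p (allFin r)
  e = ∏[ j ∈ allFin r ] (p j ℕ.^ pred (k j))

  rad : RadicalFactorisation N e L
  rad = ≡.subst (λ n → RadicalFactorisation n e L) (≡.sym N≡∏) (radicalFactorisation p-prime p-inj 1≤k)

  σ κ : ℕ → Carrier
  σ i = σ₁ η i m
  κ i = κ₁ η i m

  C : Subset r → ℕ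
  C I = (∏[ t ∈ filter (λ t → t ∈? I) (allFin r) ] totient (p t ℕ.^ k t))
        ℕ.* (∏[ s ∈ filter (λ s → ¬? (s ∈? I)) (allFin r) ] (p s ℕ.^ k s))

  -- The coefficient N ∏ (1 - [p_j ∣ i] / p_j) of `κ i`; at i = 0 it is φ(N).
  W : ℕ → ℕ
  W i = e ℕ.* deficient L i

  rhs : Carrier
  rhs = S.sumOf (positivesBelow N) (λ i → W i × κ i)

  coprime? : ℕ → ℕ
  coprime? i = 𝟙 (gcd N i ℕₚ.≟ 1)

  coprime-sum : S.sumOf (coprimesBelow N) σ ≈ totient N × σ 0 + rhs
  coprime-sum = begin
    S.sumOf (coprimesBelow N) σ
      ≈⟨ S.sum-filter-𝟙 (λ i → gcd N i ℕₚ.≟ 1) (positivesBelow N) σ ⟩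
    S.sumOf (positivesBelow N) (λ i → coprime? i × σ i)
      -- The term at i = 0 is zero by computation: `gcd N 0` is `N`, which is at least 2.
      ≈⟨ +-identityˡ _ ⟨
    S.sumOf (upTo N) (λ i → coprime? i × σ i)
      ≈⟨ σ-κ-sieve K η-root m rad ⟩
    -- The term i = 0 of the `κ`-sum is split off; it becomes φ(N) σ₁⁰(m), the quantity subtracted
    -- in the theorem.
    W 0 × κ 0 + rhs
      ≈⟨ +-congʳ (×-cong (≡.sym (totient-formula rad)) (κ₁-0≈σ₁-0 K η-root m)) ⟩
    totient N × σ 0 + rhs ∎

  -- `W i` is the product of φ(p_j^k_j) over p_j ∣ i and of p_j^k_j over the other j, that is, `C I`
  -- for the one subset I = {j : p_j ∣ i} whose indicator is nonzero.
  W-subsets : ∀ i → W i ≡ sumOf (subsets r) (λ I → C I ℕ.* 𝟙 (divisiblePrecisely? p I i))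
  W-subsets i = ≡.trans (deficient-product p-prime 1≤k i)
    (≡.sym (sum-subsets p (λ t → totient (p t ℕ.^ k t)) (λ s → p s ℕ.^ k s) i))

  subset-sum : rhs ≈ S.sumOf (subsets r) (λ I → C I × S.sumOf (filter (divisiblePrecisely? p I) (positivesBelow N)) κ)
  subset-sum = begin
    rhs
      ≈⟨ S.sum-cong (positivesBelow N) (λ i → trans (×-congˡ (W-subsets i)) (sym (S.sum-×ˡ (subsets r) _ (κ i)))) ⟩
    S.sumOf (positivesBelow N) (λ i → S.sumOf (subsets r) (λ I → (C I ℕ.* 𝟙 (divisiblePrecisely? p I i)) × κ i))
      ≈⟨ S.sum-swap (positivesBelow N) (subsets r) _ ⟩
    S.sumOf (subsets r) (λ I → S.sumOf (positivesBelow N) (λ i → (C I ℕ.* 𝟙 (divisiblePrecisely? p I i)) × κ i))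
      ≈⟨ S.sum-cong (subsets r) (λ I → begin
           S.sumOf (positivesBelow N) (λ i → (C I ℕ.* 𝟙 (divisiblePrecisely? p I i)) × κ i)
             ≈⟨ S.sum-cong (positivesBelow N) (λ i → ×-assocˡ (κ i) (C I) (𝟙 (divisiblePrecisely? p I i))) ⟨
           S.sumOf (positivesBelow N) (λ i → C I × 𝟙 (divisiblePrecisely? p I i) × κ i)
             ≈⟨ S.sum-× (positivesBelow N) (C I) _ ⟩
           C I × S.sumOf (positivesBelow N) (λ i → 𝟙 (divisiblePrecisely? p I i) × κ i)
             ≈⟨ ×-congʳ (C I) (S.sum-filter-𝟙 (divisiblePrecisely? p I) (positivesBelow N) κ) ⟨
           C I × S.sumOf (filter (divisiblePrecisely? p I) (positivesBelow N)) κ ∎) ⟩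
    S.sumOf (subsets r) (λ I → C I × S.sumOf (filter (divisiblePrecisely? p I) (positivesBelow N)) κ) ∎
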